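{- Let $\mathrm{sdf}(n)$ denote the size of the largest square-difference-free subset of $\{1,\ldots,n\}$. Then $$\mathrm{sdf}(n) \ge \Omega\bigl(n^{\frac12(1+\log_{205} 12)}\bigr),$$ where $\tfrac12(1+\log_{205}12)=0.7334\cdots$; that is, there exist a constant $C>0$ and an $n_0$ such that $\mathrm{sdf}(n)\ge C\, n^{\frac12(1+\log_{205} 12)}$ for all $n\ge n_0$.
   Context: $\mathbb{N}=\{1,2,3,\ldots\}$. A set $A\subseteq \mathbb{N}$ is square-difference free if there do not exist $x,y\in A$, $x\neq y$, such that $|x-y|$ is a perfect square (the square of an integer). For $n\in\mathbb{N}$, $\mathrm{sdf}(n)$ is the maximum cardinality of a square-difference-free subset of $\{1,\ldots,n\}$. -}

module Defs where

open import Algebra.Definitions.RawSemiring as RawSemiringDefs using ()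
open import Data.Bool.Base using (true; false)
open import Data.Fin.Base using (toℕ)
open import Data.Fin.Properties using (any?; toℕ-injective)
  renaming (_≟_ to _≟ᶠ_)
open import Data.Fin.Subset using (Subset; ∣_∣; ⊥)
  renaming (_∈_ to _∈ˢ_)
open import Data.Fin.Subset.Properties using (_∈?_; ∉⊥; ∣⊥∣≡0)
open import Data.Integer.Base as ℤ using (ℤ; +_; -[1+_])
import Data.Integer.Properties as ℤ
open import Data.List.Base using (List; []; _∷_; _++_; map; filter)
open import Data.List.Extrema.Nat using (max; xs≤max; argmax-sel)
open import Data.List.Membership.Propositional using () renaming (_∈_ to _∈ˡ_)
open import Data.List.Membership.Propositional.Properties
  using (∈-map⁺; ∈-map⁻; ∈-++⁺ˡ; ∈-++⁺ʳ; ∈-filter⁺; ∈-filter⁻)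
open import Data.List.Relation.Unary.All using (lookup)
open import Data.List.Relation.Unary.Any using (here)
open import Data.Nat.Base as ℕ
  using (ℕ; suc; NonZero; NonTrivial; nonTrivial⇒nonZero; ∣_-_∣; s≤s)
import Data.Nat.Properties as ℕ
open import Data.Product.Base using (Σ-syntax; ∃-syntax; _×_; _,_)
open import Data.Rational.Unnormalised.Base as ℚᵘ
  using (ℚᵘ; _/_; _≃_; 0ℚᵘ; ½; ↥_; ↧ₙ_)
open import Data.Sum.Base using (_⊎_; inj₁; inj₂)
open import Data.Vec.Base using ([]; _∷_)
open import Function.Base using (id; _∘_)
open import Level using (0ℓ)
open import Relation.Binary.PropositionalEquality
  using (_≡_; _≢_; refl; sym; trans; cong; subst)
open import Relation.Nullary using (¬_)
open import Relation.Nullary.Decidable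
  using (map′; _×-dec_; ¬?)
open import Relation.Unary using (Pred; _∈_; _∉_; Decidable)

------------------------------------------------------------------------
-- Square-difference-free sets

IsSquare : Pred ℕ 0ℓ
IsSquare m = ∃[ k ] + m ≡ k ℤ.* k

SquareDifferenceFree : Pred (Pred ℕ 0ℓ) 0ℓ
SquareDifferenceFree A =
  ¬ (∃[ x ] ∃[ y ] x ∈ A × y ∈ A × x ≢ y × IsSquare ∣ x - y ∣)

-- A `Subset n` is read as a subset of {1,…,n}: the index i : Fin n
-- stands for the number 1 + toℕ i.

⟦_⟧ : ∀ {n} → Subset n → Pred ℕ 0ℓ
⟦ S ⟧ x = ∃[ i ] i ∈ˢ S × x ≡ suc (toℕ i)

isSquare? : Decidable IsSquare
isSquare? m = map′ to from (ℕ.anyUpTo? (λ k → m ℕ.≟ k ℕ.* k) (suc m))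
  where
  to : (∃[ k ] k ℕ.< suc m × m ≡ k ℕ.* k) → IsSquare m
  to (k , _ , eq) = + k , trans (cong +_ eq) (ℤ.pos-* k k)

  n≤n*n : ∀ n → n ℕ.≤ n ℕ.* n
  n≤n*n ℕ.zero  = ℕ.z≤n
  n≤n*n (suc n) = ℕ.m≤m*n (suc n) (suc n)

  from : IsSquare m → ∃[ k ] k ℕ.< suc m × m ≡ k ℕ.* k
  from (k , eq) = ℤ.∣ k ∣ , s≤s (subst (ℤ.∣ k ∣ ℕ.≤_) (sym eq′) (n≤n*n ℤ.∣ k ∣)) , eq′
    where
    eq′ : m ≡ ℤ.∣ k ∣ ℕ.* ℤ.∣ k ∣
    eq′ = trans (cong ℤ.∣_∣ eq) (ℤ.abs-* k k)

squareDifferenceFree? : ∀ {n} → Decidable (SquareDifferenceFree ∘ ⟦_⟧ {n})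
squareDifferenceFree? S = ¬? (map′ to from
  (any? λ i → any? λ j →
    (i ∈? S) ×-dec (j ∈? S) ×-dec ¬? (i ≟ᶠ j) ×-dec
    isSquare? ∣ suc (toℕ i) - suc (toℕ j) ∣))
  where
  to : _ → ∃[ x ] ∃[ y ] x ∈ ⟦ S ⟧ × y ∈ ⟦ S ⟧ × x ≢ y × IsSquare ∣ x - y ∣
  to (i , j , i∈S , j∈S , i≢j , sq) =
    suc (toℕ i) , suc (toℕ j) , (i , i∈S , refl) , (j , j∈S , refl) ,
    (λ eq → i≢j (toℕ-injective (ℕ.suc-injective eq))) , sq

  from : _ → _
  from (_ , _ , (i , i∈S , refl) , (j , j∈S , refl) , x≢y , sq) =
    i , j , i∈S , j∈S , (λ i≡j → x≢y (cong (suc ∘ toℕ) i≡j)) , sq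

subsets : ∀ n → List (Subset n)
subsets ℕ.zero  = [] ∷ []
subsets (suc n) = map (true ∷_) (subsets n) ++ map (false ∷_) (subsets n)

sdf : ℕ → ℕ
sdf n = max 0 (map ∣_∣ (filter squareDifferenceFree? (subsets n)))

∈-subsets : ∀ {n} (S : Subset n) → S ∈ˡ subsets n
∈-subsets []          = here refl
∈-subsets (true  ∷ S) = ∈-++⁺ˡ (∈-map⁺ (true ∷_) (∈-subsets S))
∈-subsets (false ∷ S) = ∈-++⁺ʳ _ (∈-map⁺ (false ∷_) (∈-subsets S))

sdf-upper : ∀ {n} (S : Subset n) → SquareDifferenceFree ⟦ S ⟧ → ∣ S ∣ ℕ.≤ sdf n
sdf-upper S free = lookup (xs≤max 0 _)
  (∈-map⁺ ∣_∣ (∈-filter⁺ squareDifferenceFree? (∈-subsets S) free))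

sdf-attained : ∀ n → Σ[ S ∈ Subset n ] SquareDifferenceFree ⟦ S ⟧ × ∣ S ∣ ≡ sdf n
sdf-attained n
  with argmax-sel id 0 (map ∣_∣ (filter squareDifferenceFree? (subsets n)))
... | inj₁ eq = ⊥ , (λ { (_ , _ , (_ , i∈⊥ , _) , _) → ∉⊥ i∈⊥ }) ,
                trans (∣⊥∣≡0 n) (sym eq)
... | inj₂ sdf∈ with ∈-map⁻ ∣_∣ sdf∈
...   | S , S∈ , eq with ∈-filter⁻ squareDifferenceFree? {xs = subsets n} S∈
...     | _ , free = S , free , sym eq

------------------------------------------------------------------------
-- Real numbers as lower Dedekind cuts

-- A real number x is represented by the set of rationals strictly
-- below it: q ∈ x means q < x.

Cut : Set₁
Cut = Pred ℚᵘ 0ℓ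

infix 4 _≤ᶜ_ _<ᶜ_

_≤ᶜ_ : Cut → Cut → Set
x ≤ᶜ y = ∀ q → q ∈ x → q ∈ y

_<ᶜ_ : Cut → Cut → Set
x <ᶜ y = ∃[ q ] q ∉ x × q ∈ y

fromℚᵘ : ℚᵘ → Cut
fromℚᵘ q r = r ℚᵘ.< q

fromℕ : ℕ → Cut
fromℕ m = fromℚᵘ (+ m / 1)

infixl 6 _⊕_

_⊕_ : Cut → Cut → Cut
(x ⊕ y) q = ∃[ r ] ∃[ s ] r ∈ x × s ∈ y × q ≃ r ℚᵘ.+ s

-- Multiplication by a rational c; this is the product c·x only for c > 0.

infixr 7 _·_

_·_ : ℚᵘ → Cut → Cut
(c · x) q = ∃[ r ] r ∈ x × q ≃ c ℚᵘ.* r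

infixr 8 _^ℕ_ _^ℤ_ _^ᶜ_

_^ℕ_ : ℚᵘ → ℕ → ℚᵘ
_^ℕ_ = RawSemiringDefs._^_ ℚᵘ.+-*-rawSemiring

_^ℤ_ : (n : ℕ) → .{{NonZero n}} → ℤ → ℚᵘ
n ^ℤ (+ k)    = + (n ℕ.^ k) / 1
n ^ℤ -[1+ k ] = _/_ (+ 1) (n ℕ.^ suc k) {{ℕ.m^n≢0 n (suc k)}}

-- For b > 1, p ∈ ℤ and d ≥ 1:  p/d < log_b a  iff  b^p < a^d.

log : (b a : ℕ) → .{{NonTrivial b}} → .{{NonZero a}} → Cut
log b a r = _^ℤ_ b {{nonTrivial⇒nonZero b}} (↥ r) ℚᵘ.< + (a ℕ.^ ↧ₙ r) / 1

-- q < n^(p/d) for p ∈ ℤ and d ≥ 1: either q is negative or q^d < n^p.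

Below^ : (n : ℕ) → .{{NonZero n}} → ℚᵘ → Cut
Below^ n r q = q ℚᵘ.< 0ℚᵘ ⊎ q ^ℕ (↧ₙ r) ℚᵘ.< n ^ℤ (↥ r)

-- For n ≥ 1, n^x is the supremum of n^r over the rationals r < x.

_^ᶜ_ : (n : ℕ) → .{{NonZero n}} → Cut → Cut
(n ^ᶜ x) q = ∃[ r ] r ∈ x × q ∈ Below^ n r

-- ½(1 + log₂₀₅ 12)

α : Cut
α = ½ · (fromℕ 1 ⊕ log 205 12)

{-# OPTIONS --safe #-}

-- Ruzsa's construction. Write numbers in base 205, allow only twelve digits in
-- the even positions (the units digit being position 0) and all digits in the
-- odd positions. The twelve digits are chosen so that no two of them differ by a
-- square modulo 205. Suppose x = y + k² for two such numbers. The units digits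
-- differ by a square modulo 205, so they agree and 205 ∣ k²; as 205 is squarefree,
-- 205 ∣ k, hence 205² ∣ k², the next digits agree as well, and both can be
-- stripped. This gives sdf(205² n) ≥ 205 · 12 · sdf(n), so sdf(205²ᵏ) ≥ 2460ᵏ,
-- while n < 205²⁽ᵏ⁺¹⁾ gives nᵅ ≤ 2460ᵏ⁺¹.

module Submission where

open import Defs
open import Data.Bool.Base using (true; false; if_then_else_)
open import Data.Empty using (⊥-elim)
open import Data.Fin.Base using (Fin; toℕ; fromℕ<; combine; zero; suc; _↑ˡ_; _↑ʳ_)
open import Data.Fin.Properties
  using (all?; toℕ-combine; toℕ-↑ˡ; toℕ-injective; toℕ<n; toℕ-fromℕ<)
  renaming (_≟_ to _≟ᶠ_)
open import Data.Fin.Subset using (Subset; ∣_∣; ⊤; ⊥) renaming (_∈_ to _∈ˢ_)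
open import Data.Fin.Subset.Properties using (_∈?_; ∉⊥; ∣⊥∣≡0; ∣⊤∣≡n)
open import Data.Integer.Base as ℤ using (+_; -[1+_])
import Data.Integer.Properties as ℤ
open import Data.List.Base using ([]; _∷_)
open import Data.List.Membership.DecPropositional using () renaming (_∈?_ to listMember?)
open import Data.Nat.Base as ℕ
  using (ℕ; NonZero; NonTrivial; nonTrivial⇒nonZero; _≤_; suc; s≤s; z≤n; ∣_-_∣)
open import Data.Nat.DivMod
  using (_%_; m≡m%n+[m/n]*n; m*n%n≡0; m%n<n; m<n⇒m%n≡m; [m+kn]%n≡m%n;
         %-distribˡ-+; %-distribˡ-*)
import Data.Nat.Properties as ℕ
open import Data.Nat.Tactic.RingSolver using (solve-∀)
open import Data.Product.Base using (Σ-syntax; ∃-syntax; _×_; _,_)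
open import Data.Rational.Unnormalised.Base as ℚᵘ
  using (ℚᵘ; mkℚᵘ; 0ℚᵘ; 1ℚᵘ; ½; _/_; _<_; _≃_; *<*; *≤*; *≡*; ↥_; ↧ₙ_)
import Data.Rational.Unnormalised.Properties as ℚᵘ
open import Data.Sum.Base using (_⊎_; inj₁; inj₂)
open import Data.Unit.Base using (tt)
open import Data.Vec.Base using ([]; _∷_; _++_; tabulate; here; there)
open import Function.Base using (_∘_)
open import Relation.Binary.PropositionalEquality
  using (_≡_; refl; sym; trans; cong; cong₂; subst; subst₂; module ≡-Reasoning)
open import Relation.Nullary using (yes; no)
open import Relation.Nullary.Decidable using (from-yes; does; _→-dec_)

-- Square-difference-freeness in terms of indices

-- An additive equation over the naturals replaces the absolute difference, so that digits can be
-- compared by congruences. Passing from elements to indices shifts both by one and keeps gaps. The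
-- case k = 0 is harmless, since the conclusion is equality.
SquareGapFree : ∀ {n} → Subset n → Set
SquareGapFree S = ∀ {i j} k → i ∈ˢ S → j ∈ˢ S → toℕ i ≡ toℕ j ℕ.+ k ℕ.* k → i ≡ j

m≡n+o⇒∣m-n∣≡o : ∀ {m n o} → m ≡ n ℕ.+ o → ∣ m - n ∣ ≡ o
m≡n+o⇒∣m-n∣≡o {n = n} {o} refl = trans (ℕ.∣-∣-comm (n ℕ.+ o) n) (ℕ.∣m-m+n∣≡n n o)

squareGapFree : ∀ {n} (S : Subset n) → SquareDifferenceFree ⟦ S ⟧ → SquareGapFree S
squareGapFree S free {i} {j} k i∈S j∈S eq with i ≟ᶠ j
... | yes i≡j = i≡j
... | no  i≢j = ⊥-elim (free
  ( suc (toℕ i) , suc (toℕ j) , (i , i∈S , refl) , (j , j∈S , refl)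
  , (λ e → i≢j (toℕ-injective (ℕ.suc-injective e)))
  , + k , trans (cong +_ (m≡n+o⇒∣m-n∣≡o eq)) (ℤ.pos-* k k)))

squareDifferenceFree : ∀ {n} (S : Subset n) → SquareGapFree S → SquareDifferenceFree ⟦ S ⟧
squareDifferenceFree S gap (_ , _ , (i , i∈S , refl) , (j , j∈S , refl) , x≢y , z , sq)
  -- Only the absolute value of `z` affects its square. Comparing the indices turns the absolute
  -- difference into an addition in one of the two orders.
  with k ← ℤ.∣ z ∣ | eq ← trans (cong ℤ.∣_∣ sq) (ℤ.abs-* z z) | ℕ.≤-total (toℕ j) (toℕ i)
... | inj₁ j≤i = x≢y (cong (suc ∘ toℕ) (gap k i∈S j∈S
  (trans (sym (ℕ.m+[n∸m]≡n j≤i)) (cong (toℕ j ℕ.+_) (trans (sym (ℕ.m≤n⇒∣n-m∣≡n∸m j≤i)) eq)))))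
... | inj₂ i≤j = x≢y (sym (cong (suc ∘ toℕ) (gap k j∈S i∈S
  (trans (sym (ℕ.m+[n∸m]≡n i≤j)) (cong (toℕ i ℕ.+_) (trans (sym (ℕ.m≤n⇒∣m-n∣≡n∸m i≤j)) eq))))))

-- Concatenations and digitwise products of subsets

∣++∣ : ∀ {m n} (S : Subset m) (T : Subset n) → ∣ S ++ T ∣ ≡ ∣ S ∣ ℕ.+ ∣ T ∣
∣++∣ []          T = refl
∣++∣ (true  ∷ S) T = cong suc (∣++∣ S T)
∣++∣ (false ∷ S) T = ∣++∣ S T

∈-++⁻ : ∀ {m n} (S : Subset m) (T : Subset n) {x} → x ∈ˢ S ++ T →
        (∃[ i ] i ∈ˢ S × x ≡ i ↑ˡ n) ⊎ (∃[ j ] j ∈ˢ T × x ≡ m ↑ʳ j)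
∈-++⁻ []      T x∈ = inj₂ (_ , x∈ , refl)
∈-++⁻ (_ ∷ S) T here = inj₁ (zero , here , refl)
∈-++⁻ (_ ∷ S) T (there x∈) with ∈-++⁻ S T x∈
... | inj₁ (i , i∈S , refl) = inj₁ (suc i , there i∈S , refl)
... | inj₂ (j , j∈T , refl) = inj₂ (j , j∈T , refl)

infixr 7 _⊗_

-- As `combine i j` has value n·i + j, these are the indices whose last base-n digit lies in `T` and
-- whose leading part lies in `S`.
_⊗_ : ∀ {m n} → Subset m → Subset n → Subset (m ℕ.* n)
[]      ⊗ T = []
(b ∷ S) ⊗ T = (if b then T else ⊥) ++ S ⊗ T

∣⊗∣ : ∀ {m n} (S : Subset m) (T : Subset n) → ∣ S ⊗ T ∣ ≡ ∣ S ∣ ℕ.* ∣ T ∣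
∣⊗∣         []          T = refl
∣⊗∣         (true  ∷ S) T = trans (∣++∣ T (S ⊗ T)) (cong (∣ T ∣ ℕ.+_) (∣⊗∣ S T))
∣⊗∣ {n = n} (false ∷ S) T = trans (∣++∣ (⊥ {n}) (S ⊗ T)) (cong₂ ℕ._+_ (∣⊥∣≡0 n) (∣⊗∣ S T))

∈-⊗⁻ : ∀ {m n} (S : Subset m) (T : Subset n) {x} → x ∈ˢ S ⊗ T →
       ∃[ i ] ∃[ j ] i ∈ˢ S × j ∈ˢ T × x ≡ combine i j
∈-⊗⁻ (b ∷ S) T x∈ with ∈-++⁻ (if b then T else ⊥) (S ⊗ T) x∈
∈-⊗⁻ (true  ∷ S) T _ | inj₁ (j , j∈T , eq) = zero , j , here , j∈T , eq
∈-⊗⁻ (false ∷ S) T _ | inj₁ (j , j∈⊥ , _)  = ⊥-elim (∉⊥ j∈⊥)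
∈-⊗⁻ (b ∷ S) T _ | inj₂ (y , y∈ , refl) with ∈-⊗⁻ S T y∈
... | i , j , i∈S , j∈T , refl = suc i , j , there i∈S , j∈T , refl

-- Monotonicity of `sdf` and the appending of two digits

-- Padding an optimal subset with `⊥` on the right keeps its indices and its size.
sdf-mono : ∀ {m n} → m ≤ n → sdf m ≤ sdf n
sdf-mono {m} m≤n with ℕ.m≤n⇒∃[o]m+o≡n m≤n | sdf-attained m
... | o , refl | S , free , ∣S∣≡sdf =
  subst (_≤ sdf (m ℕ.+ o)) ∣S++⊥∣≡sdf (sdf-upper (S ++ ⊥) (squareDifferenceFree (S ++ ⊥) gap))
  where
  ∣S++⊥∣≡sdf : ∣ S ++ ⊥ {o} ∣ ≡ sdf m
  ∣S++⊥∣≡sdf = trans (∣++∣ S ⊥) (trans (cong (∣ S ∣ ℕ.+_) (∣⊥∣≡0 o)) (trans (ℕ.+-identityʳ _) ∣S∣≡sdf))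

  gap : SquareGapFree (S ++ ⊥ {o})
  gap k x∈ y∈ eq with ∈-++⁻ S ⊥ x∈ | ∈-++⁻ S ⊥ y∈
  ... | inj₂ (_ , i∈⊥ , _)   | _                    = ⊥-elim (∉⊥ i∈⊥)
  ... | inj₁ _               | inj₂ (_ , j∈⊥ , _)   = ⊥-elim (∉⊥ j∈⊥)
  ... | inj₁ (i , i∈S , refl) | inj₁ (j , j∈S , refl) =
    cong (_↑ˡ o) (squareGapFree S free k i∈S j∈S
      (trans (sym (toℕ-↑ˡ i o)) (trans eq (cong (ℕ._+ k ℕ.* k) (toℕ-↑ˡ j o)))))

SquareResidueGapFree : ∀ {m} .{{_ : NonZero m}} → Subset m → Set
SquareResidueGapFree {m} R =
  ∀ {i j} k → i ∈ˢ R → j ∈ˢ R → toℕ i ≡ (toℕ j ℕ.+ k ℕ.* k) % m → i ≡ j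

-- Equivalently, m is squarefree.
SquareRootsOfZeroTrivial : ∀ m .{{_ : NonZero m}} → Set
SquareRootsOfZeroTrivial m = ∀ k → k ℕ.* k % m ≡ 0 → k % m ≡ 0

sdf-scale : ∀ {m} .{{_ : NonZero m}} (R : Subset m) → SquareResidueGapFree R →
            SquareRootsOfZeroTrivial m → ∀ n → sdf n ℕ.* m ℕ.* ∣ R ∣ ≤ sdf (n ℕ.* m ℕ.* m)
sdf-scale {m} R gapR roots n with sdf-attained n
... | S , free , ∣S∣≡sdf =
  subst (_≤ sdf (n ℕ.* m ℕ.* m)) ∣U∣≡ (sdf-upper U (squareDifferenceFree U gap))
  where
  U : Subset (n ℕ.* m ℕ.* m)
  -- The indices m²·i + m·s + r with i in `S`, s an arbitrary digit and r in `R`.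
  U = (S ⊗ ⊤ {m}) ⊗ R

  ∣U∣≡ : ∣ U ∣ ≡ sdf n ℕ.* m ℕ.* ∣ R ∣
  ∣U∣≡ = trans (∣⊗∣ (S ⊗ ⊤ {m}) R) (cong (ℕ._* ∣ R ∣)
    (trans (∣⊗∣ S ⊤) (cong₂ ℕ._*_ ∣S∣≡sdf (∣⊤∣≡n m))))

  lastDigit : ∀ a (d : Fin m) → (m ℕ.* a ℕ.+ toℕ d) % m ≡ toℕ d
  lastDigit a d = begin
    (m ℕ.* a ℕ.+ toℕ d) % m ≡⟨ cong (_% m) (trans (ℕ.+-comm (m ℕ.* a) _) (cong (toℕ d ℕ.+_) (ℕ.*-comm m a))) ⟩
    (toℕ d ℕ.+ a ℕ.* m) % m ≡⟨ [m+kn]%n≡m%n (toℕ d) a m ⟩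
    toℕ d % m               ≡⟨ m<n⇒m%n≡m (toℕ<n d) ⟩
    toℕ d                   ∎
    where open ≡-Reasoning

  compareDigits : ∀ {a b} (d e : Fin m) g → m ℕ.* a ℕ.+ toℕ d ≡ m ℕ.* b ℕ.+ toℕ e ℕ.+ g →
                  toℕ d ≡ (toℕ e ℕ.+ g) % m
  compareDigits {a} {b} d e g eq = begin
    toℕ d                             ≡⟨ lastDigit a d ⟨
    (m ℕ.* a ℕ.+ toℕ d) % m           ≡⟨ cong (_% m) eq ⟩
    (m ℕ.* b ℕ.+ toℕ e ℕ.+ g) % m     ≡⟨ cong (_% m) (shuffle m b (toℕ e) g) ⟩
    (toℕ e ℕ.+ g ℕ.+ b ℕ.* m) % m     ≡⟨ [m+kn]%n≡m%n (toℕ e ℕ.+ g) b m ⟩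
    (toℕ e ℕ.+ g) % m                 ∎
    where
    open ≡-Reasoning
    shuffle : ∀ m b e g → m ℕ.* b ℕ.+ e ℕ.+ g ≡ e ℕ.+ g ℕ.+ b ℕ.* m
    shuffle = solve-∀

  cancelDigit : ∀ {a b} d g → a ℕ.+ d ≡ b ℕ.+ d ℕ.+ g → a ≡ b ℕ.+ g
  cancelDigit {a} {b} d g eq = ℕ.+-cancelʳ-≡ d a (b ℕ.+ g) (trans eq (shuffle b d g))
    where
    shuffle : ∀ b d g → b ℕ.+ d ℕ.+ g ≡ b ℕ.+ g ℕ.+ d
    shuffle = solve-∀

  [b+l*m]%m : ∀ b l → (b ℕ.+ m ℕ.* l) % m ≡ b % m
  [b+l*m]%m b l = trans (cong (λ x → (b ℕ.+ x) % m) (ℕ.*-comm m l)) ([m+kn]%n≡m%n b l m)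

  gap : SquareGapFree U
  gap {x} {y} k x∈ y∈ eq
    with a , r , a∈ , r∈R , refl ← ∈-⊗⁻ (S ⊗ ⊤ {m}) R x∈
       | b , r′ , b∈ , r′∈R , refl ← ∈-⊗⁻ (S ⊗ ⊤ {m}) R y∈
    with eq₁ ← trans (sym (toℕ-combine a r)) (trans eq (cong (ℕ._+ k ℕ.* k) (toℕ-combine b r′)))
    -- Modulo m only the units digits and k² survive, so `gapR` identifies the two digits.
    with refl ← gapR k r∈R r′∈R (compareDigits r r′ (k ℕ.* k) eq₁)
    with eq₂ ← cancelDigit (toℕ r) (k ℕ.* k) eq₁
    with i , s , i∈S , _ , refl ← ∈-⊗⁻ S ⊤ a∈
       | j , s′ , j∈S , _ , refl ← ∈-⊗⁻ S ⊤ b∈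
    = cong (λ z → combine z r) a≡b
    where
    A = toℕ (combine i s)
    B = toℕ (combine j s′)

    -- With the common units digit cancelled, m·A = m·B + k², so m divides k².
    k%m≡0 : k % m ≡ 0
    k%m≡0 = roots k (begin
      k ℕ.* k % m                           ≡⟨ [b+l*m]%m (k ℕ.* k) B ⟨
      (k ℕ.* k ℕ.+ m ℕ.* B) % m             ≡⟨ cong (_% m) (trans (ℕ.+-comm (k ℕ.* k) (m ℕ.* B)) (sym eq₂)) ⟩
      (0 ℕ.+ m ℕ.* A) % m                   ≡⟨ [b+l*m]%m 0 A ⟩
      0 % m                                 ≡⟨ m*n%n≡0 0 m ⟩
      0                                     ∎)
      where open ≡-Reasoning

    k′ = k ℕ./ m

    k≡ : k ≡ k′ ℕ.* m
    k≡ = trans (m≡m%n+[m/n]*n k m) (cong (ℕ._+ k′ ℕ.* m) k%m≡0)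

    -- Dividing m²·k′² by m leaves a multiple of m. The next digits therefore agree without any
    -- restriction on them, which is why all of `⊤` is allowed there.
    eq₃ : A ≡ B ℕ.+ m ℕ.* (k′ ℕ.* k′)
    eq₃ = ℕ.*-cancelˡ-≡ A (B ℕ.+ m ℕ.* (k′ ℕ.* k′)) m
      (trans eq₂ (trans (cong (λ k → m ℕ.* B ℕ.+ k ℕ.* k) k≡) (shuffle m B k′)))
      where
      shuffle : ∀ m B l → m ℕ.* B ℕ.+ l ℕ.* m ℕ.* (l ℕ.* m) ≡ m ℕ.* (B ℕ.+ m ℕ.* (l ℕ.* l))
      shuffle = solve-∀

    eq₄ : m ℕ.* toℕ i ℕ.+ toℕ s ≡ m ℕ.* toℕ j ℕ.+ toℕ s′ ℕ.+ m ℕ.* (k′ ℕ.* k′)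
    eq₄ = trans (sym (toℕ-combine i s)) (trans eq₃ (cong (ℕ._+ m ℕ.* (k′ ℕ.* k′)) (toℕ-combine j s′)))

    s≡s′ : s ≡ s′
    s≡s′ = toℕ-injective (trans (compareDigits s s′ (m ℕ.* (k′ ℕ.* k′)) eq₄)
      (trans ([b+l*m]%m (toℕ s′) (k′ ℕ.* k′)) (m<n⇒m%n≡m (toℕ<n s′))))

    eq₅ : m ℕ.* toℕ i ≡ m ℕ.* toℕ j ℕ.+ m ℕ.* (k′ ℕ.* k′)
    eq₅ = cancelDigit {b = m ℕ.* toℕ j} (toℕ s) _
      (trans eq₄ (cong (λ s → m ℕ.* toℕ j ℕ.+ toℕ s ℕ.+ m ℕ.* (k′ ℕ.* k′)) (sym s≡s′)))

    i≡j : i ≡ j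
    -- The gap that remains between the leading parts is k′², again a square.
    i≡j = squareGapFree S free k′ i∈S j∈S
      (ℕ.*-cancelˡ-≡ _ _ m (trans eq₅ (sym (ℕ.*-distribˡ-+ m (toℕ j) _))))

    a≡b : combine i s ≡ combine j s′
    a≡b = cong₂ combine i≡j s≡s′

-- Iterating the two-digit step, and rounding down to powers

1≤sdf1 : 1 ≤ sdf 1
1≤sdf1 = sdf-upper (⊤ {1}) (squareDifferenceFree ⊤ λ { {zero} {zero} _ _ _ _ → refl })

sdf-power : ∀ {m} .{{_ : NonZero m}} (R : Subset m) → SquareResidueGapFree R →
            SquareRootsOfZeroTrivial m → ∀ k → (m ℕ.* ∣ R ∣) ℕ.^ k ≤ sdf ((m ℕ.* m) ℕ.^ k)
sdf-power     R gapR roots ℕ.zero  = 1≤sdf1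
sdf-power {m} R gapR roots (suc k) = begin
  m ℕ.* ∣ R ∣ ℕ.* (m ℕ.* ∣ R ∣) ℕ.^ k          ≡⟨ ℕ.*-comm (m ℕ.* ∣ R ∣) _ ⟩
  (m ℕ.* ∣ R ∣) ℕ.^ k ℕ.* (m ℕ.* ∣ R ∣)        ≤⟨ ℕ.*-monoˡ-≤ (m ℕ.* ∣ R ∣) (sdf-power R gapR roots k) ⟩
  sdf ((m ℕ.* m) ℕ.^ k) ℕ.* (m ℕ.* ∣ R ∣)      ≡⟨ ℕ.*-assoc (sdf ((m ℕ.* m) ℕ.^ k)) m ∣ R ∣ ⟨
  sdf ((m ℕ.* m) ℕ.^ k) ℕ.* m ℕ.* ∣ R ∣        ≤⟨ sdf-scale R gapR roots ((m ℕ.* m) ℕ.^ k) ⟩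
  sdf ((m ℕ.* m) ℕ.^ k ℕ.* m ℕ.* m)            ≡⟨ cong sdf (shuffle m ((m ℕ.* m) ℕ.^ k)) ⟩
  sdf (m ℕ.* m ℕ.* (m ℕ.* m) ℕ.^ k)            ∎
  where
  open ℕ.≤-Reasoning
  shuffle : ∀ m n → n ℕ.* m ℕ.* m ≡ m ℕ.* m ℕ.* n
  shuffle = solve-∀

between-powers : ∀ b → 1 ℕ.< b → ∀ n .{{_ : NonZero n}} → ∃[ k ] b ℕ.^ k ≤ n × n ℕ.< b ℕ.^ suc k
between-powers b 1<b 1 = 0 , ℕ.≤-refl , subst (1 ℕ.<_) (sym (ℕ.*-identityʳ b)) 1<b
between-powers b 1<b (suc n@(suc _)) with between-powers b 1<b n
... | k , bᵏ≤n , n<bᵏ⁺¹ with ℕ.m≤n⇒m<n∨m≡n n<bᵏ⁺¹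
...   | inj₁ 1+n<bᵏ⁺¹ = k , ℕ.m≤n⇒m≤1+n bᵏ≤n , 1+n<bᵏ⁺¹
...   | inj₂ 1+n≡bᵏ⁺¹ = suc k , ℕ.≤-reflexive (sym 1+n≡bᵏ⁺¹) ,
  subst (ℕ._< b ℕ.^ suc (suc k)) (sym 1+n≡bᵏ⁺¹) (ℕ.^-monoʳ-< b 1<b (ℕ.n<1+n (suc k)))

-- The twelve digits modulo 205

residues : Subset 205
residues = tabulate λ i → does (listMember? ℕ._≟_ (toℕ i)
  (0 ∷ 2 ∷ 8 ∷ 14 ∷ 77 ∷ 79 ∷ 85 ∷ 96 ∷ 103 ∷ 109 ∷ 111 ∷ 181 ∷ []))

-- Decided by exhaustive search. Each membership test precedes the next quantifier, so only the
-- twelve digits reach the inner searches.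
residues-check : ∀ i → i ∈ˢ residues → ∀ j → j ∈ˢ residues → ∀ (k : Fin 205) →
                 toℕ i ≡ (toℕ j ℕ.+ toℕ k ℕ.* toℕ k) % 205 → i ≡ j
residues-check = from-yes
  (all? λ i → (i ∈? residues) →-dec all? λ j → (j ∈? residues) →-dec all? λ (k : Fin 205) →
    (toℕ i ℕ.≟ (toℕ j ℕ.+ toℕ k ℕ.* toℕ k) % 205) →-dec (i ≟ᶠ j))

roots-check : ∀ (k : Fin 205) → toℕ k ℕ.* toℕ k % 205 ≡ 0 → toℕ k ≡ 0
roots-check = from-yes (all? λ (k : Fin 205) →
  (toℕ k ℕ.* toℕ k % 205 ℕ.≟ 0) →-dec (toℕ k ℕ.≟ 0))

-- Extends the finite checks over `Fin 205` to every natural k.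
square-% : ∀ k → let k̄ = toℕ (fromℕ< (m%n<n k 205)) in k ℕ.* k % 205 ≡ k̄ ℕ.* k̄ % 205
square-% k = trans (%-distribˡ-* k k 205)
  (cong (λ x → x ℕ.* x % 205) (sym (toℕ-fromℕ< (m%n<n k 205))))

squareResidueGapFree : SquareResidueGapFree residues
squareResidueGapFree {i} {j} k i∈ j∈ eq = residues-check i i∈ j j∈ (fromℕ< (m%n<n k 205)) (begin
  toℕ i                                   ≡⟨ eq ⟩
  (toℕ j ℕ.+ k ℕ.* k) % 205               ≡⟨ %-distribˡ-+ (toℕ j) (k ℕ.* k) 205 ⟩
  (toℕ j % 205 ℕ.+ k ℕ.* k % 205) % 205   ≡⟨ cong (λ x → (toℕ j % 205 ℕ.+ x) % 205) (square-% k) ⟩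
  (toℕ j % 205 ℕ.+ k̄ ℕ.* k̄ % 205) % 205   ≡⟨ %-distribˡ-+ (toℕ j) (k̄ ℕ.* k̄) 205 ⟨
  (toℕ j ℕ.+ k̄ ℕ.* k̄) % 205               ∎)
  where
  open ≡-Reasoning
  k̄ = toℕ (fromℕ< (m%n<n k 205))

squareRootsOfZeroTrivial : SquareRootsOfZeroTrivial 205
squareRootsOfZeroTrivial k k²≡0 = trans (sym (toℕ-fromℕ< (m%n<n k 205)))
  (roots-check (fromℕ< (m%n<n k 205)) (trans (sym (square-% k)) k²≡0))

sdf-lower : ∀ n .{{_ : NonZero n}} → ∃[ k ] 2460 ℕ.^ k ≤ sdf n × n ℕ.< (205 ℕ.* 205) ℕ.^ suc k
sdf-lower n with between-powers (205 ℕ.* 205) (ℕ.<ᵇ⇒< _ _ tt) n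
... | k , lo , hi = k ,
  -- Here `205 ℕ.* ∣ residues ∣` is evaluated to 2460, which confirms that there are twelve digits.
  ℕ.≤-trans (sdf-power residues squareResidueGapFree squareRootsOfZeroTrivial k) (sdf-mono lo) , hi

-- Naturals inside the rationals, and powers

/1-mono-≤ : ∀ {m n} → m ≤ n → + m / 1 ℚᵘ.≤ + n / 1
/1-mono-≤ m≤n = *≤* (ℤ.*-monoʳ-≤-nonNeg (+ 1) (ℤ.+≤+ m≤n))

/1-mono-< : ∀ {m n} → m ℕ.< n → + m / 1 < + n / 1
/1-mono-< m<n = *<* (ℤ.*-monoʳ-<-pos (+ 1) (ℤ.+<+ m<n))

/1-cancel-< : ∀ {m n} → + m / 1 < + n / 1 → m ℕ.< n
/1-cancel-< (*<* lt) = ℤ.drop‿+<+ (ℤ.*-cancelʳ-<-nonNeg (+ 1) lt)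

/1-*-homo : ∀ m n → + (m ℕ.* n) / 1 ≃ (+ m / 1) ℚᵘ.* (+ n / 1)
/1-*-homo m n = *≡* (cong (ℤ._* + 1) (ℤ.pos-* m n))

^ℕ-/1 : ∀ m d → (+ m / 1) ^ℕ d ≃ + (m ℕ.^ d) / 1
^ℕ-/1 m ℕ.zero  = ℚᵘ.≃-refl
^ℕ-/1 m (suc d) = ℚᵘ.≃-trans (ℚᵘ.*-congˡ {+ m / 1} (^ℕ-/1 m d)) (ℚᵘ.≃-sym (/1-*-homo m (m ℕ.^ d)))

1/m≤1 : ∀ m .{{_ : NonZero m}} → + 1 / m ℚᵘ.≤ 1ℚᵘ
1/m≤1 (suc m) = *≤* (ℤ.+≤+ (s≤s z≤n))

^ℕ-nonNegative : ∀ {q} d → 0ℚᵘ ℚᵘ.≤ q → 0ℚᵘ ℚᵘ.≤ q ^ℕ d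
^ℕ-nonNegative ℕ.zero  0≤q = *≤* (ℤ.+≤+ z≤n)
^ℕ-nonNegative {q} (suc d) 0≤q = ℚᵘ.≤-trans (ℚᵘ.≤-reflexive (ℚᵘ.≃-sym (ℚᵘ.*-zeroʳ q)))
  (ℚᵘ.*-monoʳ-≤-nonNeg q {{ℚᵘ.nonNegative 0≤q}} (^ℕ-nonNegative d 0≤q))

^ℕ-mono-≤ : ∀ {p q} d → 0ℚᵘ ℚᵘ.≤ p → p ℚᵘ.≤ q → p ^ℕ d ℚᵘ.≤ q ^ℕ d
^ℕ-mono-≤ ℕ.zero  0≤p p≤q = ℚᵘ.≤-refl
^ℕ-mono-≤ {p} (suc d) 0≤p p≤q =
  ℚᵘ.*-mono-≤-nonNeg {{ℚᵘ.nonNegative 0≤p}} {{ℚᵘ.nonNegative (^ℕ-nonNegative d 0≤p)}}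
    p≤q (^ℕ-mono-≤ d 0≤p p≤q)

^-cancelˡ-≤ : ∀ {x y} n .{{_ : NonZero n}} → x ℕ.^ n ≤ y ℕ.^ n → x ≤ y
^-cancelˡ-≤ n xⁿ≤yⁿ = ℕ.≮⇒≥ λ y<x → ℕ.<⇒≱ (ℕ.^-monoˡ-< n y<x) xⁿ≤yⁿ

^-distribʳ-* : ∀ x y n → (x ℕ.* y) ℕ.^ n ≡ x ℕ.^ n ℕ.* y ℕ.^ n
^-distribʳ-* x y ℕ.zero  = refl
^-distribʳ-* x y (suc n) = trans (cong (x ℕ.* y ℕ.*_) (^-distribʳ-* x y n)) (shuffle x y (x ℕ.^ n) (y ℕ.^ n))
  where
  shuffle : ∀ x y u v → x ℕ.* y ℕ.* (u ℕ.* v) ≡ x ℕ.* u ℕ.* (y ℕ.* v)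
  shuffle = solve-∀

^-comm : ∀ x m n → (x ℕ.^ m) ℕ.^ n ≡ (x ℕ.^ n) ℕ.^ m
^-comm x m n = trans (ℕ.^-*-assoc x m n) (trans (cong (x ℕ.^_) (ℕ.*-comm m n)) (sym (ℕ.^-*-assoc x n m)))

-- From the cuts to inequalities between natural powers

-- Avoids taking a d-th root: a `q` at or above `B` would have d-th power at least B^d, hence at
-- least n^p, against `q` lying below n^(p/d). A negative `q` is below `B` anyway.
Below^-bound : ∀ {n} .{{_ : NonZero n}} {q} r B → n ^ℤ (↥ r) ℚᵘ.≤ + (B ℕ.^ ↧ₙ r) / 1 →
               Below^ n r q → q < + B / 1
Below^-bound r B bound (inj₁ q<0) = ℚᵘ.<-≤-trans q<0 (/1-mono-≤ z≤n)
Below^-bound {q = q} r B bound (inj₂ qᵈ<nᵖ) = ℚᵘ.≰⇒> λ B≤q → ℚᵘ.<⇒≱ qᵈ<nᵖ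
  (ℚᵘ.≤-trans bound (ℚᵘ.≤-trans (ℚᵘ.≤-reflexive (ℚᵘ.≃-sym (^ℕ-/1 B (↧ₙ r))))
    (^ℕ-mono-≤ (↧ₙ r) (/1-mono-≤ z≤n) B≤q)))

-- With D = suc d and F = suc f, the exponent is cleared of denominators by comparing F-th powers.
power-bound : ∀ {b a} .{{_ : NonZero b}} P d e f → b ℕ.^ e ≤ a ℕ.^ suc f →
  (+ 2 / 1) ℚᵘ.* mkℚᵘ (+ P) d < 1ℚᵘ ℚᵘ.+ mkℚᵘ (+ e) f →
  b ℕ.^ (2 ℕ.* P) ≤ (b ℕ.* a) ℕ.^ suc d
power-bound {b} {a} P d e f bᵉ≤aᶠ (*<* lt) = ^-cancelˡ-≤ F (begin
  (b ℕ.^ (2 ℕ.* P)) ℕ.^ F                ≡⟨ ℕ.^-*-assoc b (2 ℕ.* P) F ⟩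
  b ℕ.^ (2 ℕ.* P ℕ.* F)                  ≤⟨ ℕ.^-monoʳ-≤ b (ℕ.<⇒≤ lt′) ⟩
  b ℕ.^ ((F ℕ.+ e) ℕ.* D)                ≡⟨ ℕ.^-*-assoc b (F ℕ.+ e) D ⟨
  (b ℕ.^ (F ℕ.+ e)) ℕ.^ D                ≡⟨ cong (ℕ._^ D) (ℕ.^-distribˡ-+-* b F e) ⟩
  (b ℕ.^ F ℕ.* b ℕ.^ e) ℕ.^ D            ≤⟨ ℕ.^-monoˡ-≤ D (ℕ.*-monoʳ-≤ (b ℕ.^ F) bᵉ≤aᶠ) ⟩
  (b ℕ.^ F ℕ.* a ℕ.^ F) ℕ.^ D            ≡⟨ cong (ℕ._^ D) (^-distribʳ-* b a F) ⟨
  ((b ℕ.* a) ℕ.^ F) ℕ.^ D                ≡⟨ ^-comm (b ℕ.* a) F D ⟩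
  ((b ℕ.* a) ℕ.^ D) ℕ.^ F                ∎)
  where
  open ℕ.≤-Reasoning
  D = suc d
  F = suc f

  lt′ : 2 ℕ.* P ℕ.* F ℕ.< (F ℕ.+ e) ℕ.* D
  lt′ = ℤ.drop‿+<+ (subst₂ ℤ._<_ lhs rhs lt)
    where
    lhs : (+ 2 ℤ.* + P) ℤ.* + (1 ℕ.* F) ≡ + (2 ℕ.* P ℕ.* F)
    lhs = trans (cong₂ ℤ._*_ (sym (ℤ.pos-* 2 P)) (cong +_ (ℕ.*-identityˡ F))) (sym (ℤ.pos-* (2 ℕ.* P) F))

    rhs : (+ 1 ℤ.* + F ℤ.+ + e ℤ.* + 1) ℤ.* + (1 ℕ.* D) ≡ + ((F ℕ.+ e) ℕ.* D)
    rhs = trans (cong₂ ℤ._*_ (cong₂ ℤ._+_ (ℤ.*-identityˡ (+ F)) (ℤ.*-identityʳ (+ e))) (cong +_ (ℕ.*-identityˡ D)))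
      (sym (ℤ.pos-* (F ℕ.+ e) D))

log-bound : ∀ {b a} .{{_ : NonTrivial b}} .{{_ : NonZero a}} P d v → log b a v →
  (+ 2 / 1) ℚᵘ.* mkℚᵘ (+ P) d < 1ℚᵘ ℚᵘ.+ v →
  b ℕ.^ (2 ℕ.* P) ≤ (b ℕ.* a) ℕ.^ suc d
log-bound {b} P d (mkℚᵘ (+ e) f) v∈log lt =
  power-bound {{nonTrivial⇒nonZero b}} P d e f (ℕ.<⇒≤ (/1-cancel-< v∈log)) lt
-- A negative `v` is replaced by the larger 0/1, for which the premise of `power-bound` is b^0 ≤
-- a^1.
log-bound {b} {a} P d v@(mkℚᵘ -[1+ _ ] _) v∈log lt =
  power-bound {{nonTrivial⇒nonZero b}} P d 0 0 (ℕ.m^n>0 a 1)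
    (ℚᵘ.<-≤-trans lt (ℚᵘ.+-monoʳ-≤ 1ℚᵘ {v} {0ℚᵘ} (*≤* ℤ.-≤+)))

2*[½*t]≃t : ∀ t → (+ 2 / 1) ℚᵘ.* (½ ℚᵘ.* t) ≃ t
2*[½*t]≃t t = ℚᵘ.≃-trans (ℚᵘ.≃-sym (ℚᵘ.*-assoc (+ 2 / 1) ½ t))
  (ℚᵘ.≃-trans (ℚᵘ.*-congʳ {t} (*≡* {(+ 2 / 1) ℚᵘ.* ½} {1ℚᵘ} refl)) (ℚᵘ.*-identityˡ t))

-- Doubling clears the factor ½, and adding 1 to the logarithm multiplies its argument 12 by 205,
-- giving 2460. In effect α = ½ log₂₀₅ 2460.
α-bound : ∀ P d → α (mkℚᵘ (+ P) d) → 205 ℕ.^ (2 ℕ.* P) ≤ 2460 ℕ.^ suc d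
α-bound P d (t , (u , v , u<1 , v∈log , t≃u+v) , r≃½t) = log-bound {205} {12} P d v v∈log (begin-strict
  (+ 2 / 1) ℚᵘ.* mkℚᵘ (+ P) d   ≃⟨ ℚᵘ.*-congˡ {+ 2 / 1} r≃½t ⟩
  (+ 2 / 1) ℚᵘ.* (½ ℚᵘ.* t)     ≃⟨ 2*[½*t]≃t t ⟩
  t                             ≃⟨ t≃u+v ⟩
  u ℚᵘ.+ v                      <⟨ ℚᵘ.+-monoˡ-< v u<1 ⟩
  1ℚᵘ ℚᵘ.+ v                    ∎)
  where open ℚᵘ.≤-Reasoning

-- Decimal bounds for α

α-lower : fromℚᵘ (+ 7334 / 10000) ≤ᶜ α
α-lower q q<0·7334 = t , (t ℚᵘ.- v , v , t-v<1 , v∈log , ℚᵘ.≃-sym t-v+v≃t) , q≃½t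
  where
  -- 1 + v = 2 · 0.7334, and v lies just below log₂₀₅ 12 = 0.46682…
  v = + 1167 / 2500
  t = (+ 2 / 1) ℚᵘ.* q

  v∈log : log 205 12 v
  v∈log = /1-mono-< {205 ℕ.^ 1167} {12 ℕ.^ 2500} (ℕ.<ᵇ⇒< _ _ tt)

  t-v<1 : t ℚᵘ.- v < + 1 / 1
  t-v<1 = ℚᵘ.<-≤-trans (ℚᵘ.+-monoˡ-< (ℚᵘ.- v) (ℚᵘ.*-monoʳ-<-pos (+ 2 / 1) q<0·7334))
    (from-yes ((+ 2 / 1) ℚᵘ.* (+ 7334 / 10000) ℚᵘ.- v ℚᵘ.≤? + 1 / 1))

  t-v+v≃t : t ℚᵘ.- v ℚᵘ.+ v ≃ t
  t-v+v≃t = ℚᵘ.≃-trans (ℚᵘ.+-assoc t (ℚᵘ.- v) v)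
    (ℚᵘ.≃-trans (ℚᵘ.+-congʳ t (ℚᵘ.+-inverseˡ v)) (ℚᵘ.+-identityʳ t))

  q≃½t : q ≃ ½ ℚᵘ.* t
  q≃½t = ℚᵘ.≃-sym (ℚᵘ.≃-trans (ℚᵘ.≃-sym (ℚᵘ.*-assoc ½ (+ 2 / 1) q))
    (ℚᵘ.≃-trans (ℚᵘ.*-congʳ {q} (*≡* {½ ℚᵘ.* (+ 2 / 1)} {1ℚᵘ} refl)) (ℚᵘ.*-identityˡ q)))

-- 300/409 = 0.73349… lies between α = 0.73341… and 0.7335.
α-upper : α <ᶜ fromℚᵘ (+ 7335 / 10000)
α-upper = + 300 / 409 , (λ q∈α → ℕ.≤⇒≯ (α-bound 300 408 q∈α) (ℕ.<ᵇ⇒< _ _ tt)) ,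
  from-yes (+ 300 / 409 ℚᵘ.<? + 7335 / 10000)


-- Comparing n^α with powers of 2460

^α-bound : ∀ {n k} .{{_ : NonZero n}} → n ℕ.< (205 ℕ.* 205) ℕ.^ suc k → ∀ {q} →
           (n ^ᶜ α) q → q < + (2460 ℕ.^ suc k) / 1
^α-bound {n} {k} n<b (r@(mkℚᵘ (+ P) d) , r∈α , below) =
  Below^-bound r (2460 ℕ.^ suc k) (/1-mono-≤ (begin
    n ℕ.^ P                               ≤⟨ ℕ.^-monoˡ-≤ P (ℕ.<⇒≤ n<b) ⟩
    -- `205 ℕ.* 205` and `205 ℕ.^ 2` agree by evaluation. The exponents are then permuted until
    -- `α-bound` applies to the inner power.
    ((205 ℕ.^ 2) ℕ.^ suc k) ℕ.^ P         ≡⟨ ^-comm (205 ℕ.^ 2) (suc k) P ⟩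
    ((205 ℕ.^ 2) ℕ.^ P) ℕ.^ suc k         ≡⟨ cong (ℕ._^ suc k) (ℕ.^-*-assoc 205 2 P) ⟩
    (205 ℕ.^ (2 ℕ.* P)) ℕ.^ suc k         ≤⟨ ℕ.^-monoˡ-≤ (suc k) (α-bound P d r∈α) ⟩
    (2460 ℕ.^ suc d) ℕ.^ suc k            ≡⟨ ^-comm 2460 (suc d) (suc k) ⟩
    (2460 ℕ.^ suc k) ℕ.^ suc d            ∎)) below
  where open ℕ.≤-Reasoning
-- For a negative exponent the power of n is at most 1, which is at most any power of 2460.
^α-bound {n} {k} n<b (r@(mkℚᵘ -[1+ p ] d) , _ , below) =
  Below^-bound r (2460 ℕ.^ suc k)
    (ℚᵘ.≤-trans (1/m≤1 (n ℕ.^ suc p) {{ℕ.m^n≢0 n (suc p)}})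
      (/1-mono-≤ (ℕ.m^n>0 (2460 ℕ.^ suc k) {{ℕ.m^n≢0 2460 (suc k)}} (suc d)))) below

1/b*bᵏ⁺¹≃bᵏ : ∀ b .{{_ : NonZero b}} k → (+ 1 / b) ℚᵘ.* (+ (b ℕ.^ suc k) / 1) ≃ + (b ℕ.^ k) / 1
1/b*bᵏ⁺¹≃bᵏ b@(suc _) k = *≡* (begin
  + 1 ℤ.* + (b ℕ.* b ℕ.^ k) ℤ.* + 1   ≡⟨ ℤ.*-identityʳ (+ 1 ℤ.* + (b ℕ.* b ℕ.^ k)) ⟩
  + 1 ℤ.* + (b ℕ.* b ℕ.^ k)           ≡⟨ ℤ.*-identityˡ (+ (b ℕ.* b ℕ.^ k)) ⟩
  + (b ℕ.* b ℕ.^ k)                   ≡⟨ cong +_ (shuffle b (b ℕ.^ k)) ⟩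
  + (b ℕ.^ k ℕ.* (b ℕ.* 1))           ≡⟨ ℤ.pos-* (b ℕ.^ k) (b ℕ.* 1) ⟩
  + (b ℕ.^ k) ℤ.* + (b ℕ.* 1)         ∎)
  where
  open ≡-Reasoning
  shuffle : ∀ b x → b ℕ.* x ≡ x ℕ.* (b ℕ.* 1)
  shuffle = solve-∀

-- The constant 1/2460 pays for rounding n down: n^α is only bounded by 2460^(k+1), while `sdf n` is
-- only known to reach 2460^k.
growth : ∀ {n k} .{{_ : NonZero n}} → 2460 ℕ.^ k ≤ sdf n → n ℕ.< (205 ℕ.* 205) ℕ.^ suc k →
         (+ 1 / 2460) · (n ^ᶜ α) ≤ᶜ fromℕ (sdf n)
growth {n} {k} lo hi q (q′ , q′∈ , q≃C*q′) = begin-strict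
  q                                              ≃⟨ q≃C*q′ ⟩
  (+ 1 / 2460) ℚᵘ.* q′                           <⟨ ℚᵘ.*-monoʳ-<-pos (+ 1 / 2460) (^α-bound {n} {k} hi q′∈) ⟩
  (+ 1 / 2460) ℚᵘ.* (+ (2460 ℕ.^ suc k) / 1)     ≃⟨ 1/b*bᵏ⁺¹≃bᵏ 2460 k ⟩
  + (2460 ℕ.^ k) / 1                             ≤⟨ /1-mono-≤ lo ⟩
  + (sdf n) / 1                                  ∎
  where open ℚᵘ.≤-Reasoning

theorem3p7 : (Σ[ C ∈ ℚᵘ ] 0ℚᵘ < C × (Σ[ n₀ ∈ ℕ ]
    ((n : ℕ) → .{{_ : NonZero n}} → n₀ ≤ n →
    C · (n ^ᶜ α) ≤ᶜ fromℕ (sdf n))))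
    × (fromℚᵘ (+ 7334 / 10000) ≤ᶜ α × α <ᶜ fromℚᵘ (+ 7335 / 10000))
-- Every n ≥ 1 lies between consecutive powers of 205², so the threshold can be 0.
theorem3p7 = (+ 1 / 2460 , ℚᵘ.positive⁻¹ (+ 1 / 2460) , 0 ,
  λ n _ → let k , lo , hi = sdf-lower n in growth {n} {k} lo hi) , α-lower , α-upper
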